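{- Let $k\ge2$ be even, let $p\ge2$ be an integer, and let $G=C(p,p,\dots,p)$ ($k$ entries, all equal to $p$). Then the number $m(G)$ of distinct Laplacian eigenvalues of $G$ equals $k+1$.
   Context: $C(\alpha_1,\dots,\alpha_k)$ is defined recursively by $C(\alpha_1)=\overline{K_{\alpha_1}}$ (edgeless graph) and $C(\alpha_1,\dots,\alpha_i)=\overline{C(\alpha_1,\dots,\alpha_{i-1})\cup K_{\alpha_i}}$ for $i=2,\dots,k$ (disjoint union, then complement). Equivalently for $k$ even, with $\pi_i$ the $\alpha_i$ vertices introduced at step $i$: $\pi_i$ is a clique for $i$ odd, independent for $i$ even, and for $i<j$ vertices of $\pi_i,\pi_j$ are adjacent iff $j$ is even. Laplacian eigenvalues are those of $L=D-A$. -}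

module Defs where

open import Algebra.Bundles using (CommutativeRing)
open import Data.Bool.Base using (Bool; false; not; _∧_; if_then_else_)
open import Data.Fin.Base using (Fin; splitAt)
open import Data.Fin.Properties using (_≟_)
open import Data.Fin.Subset using (Subset)
import Data.Fin.Subset as Subset
import Data.List.Base as List
open import Data.List.NonEmpty using (List⁺; _∷_)
open import Data.Nat.Base using (ℕ; _≥_; _⊔_)
import Data.Nat.Base as ℕ
import Data.Nat.Properties as ℕₚ
open import Data.Product.Base using (Σ; ∃; ∃-syntax; _×_; _,_; proj₁; proj₂)
open import Data.Rational.Base using (ℚ; 0ℚ; 1ℚ; ½; ∣_∣; _<_; _≤_; _+_; _*_; _-_; -_; 1/_; Positive; positive; NonZero)
import Data.Rational.Properties as ℚₚ
open import Data.Rational.Solver using (module +-*-Solver)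
open import Data.Sum.Base using (_⊎_; inj₁; inj₂)
open import Data.Vec.Base using (tabulate)
open import Data.Vec.Functional using (Vector)
open import Function.Bundles using (Bijection)
open import Level using (0ℓ) renaming (_⊔_ to _⊔ˡ_)
open import Relation.Binary.Bundles using (Setoid)
open import Relation.Binary.PropositionalEquality using (_≡_; refl; sym; trans; cong; cong₂; subst; setoid)
open import Relation.Nullary.Decidable using (⌊_⌋; yes; no)
open import Relation.Nullary.Negation using (¬_; contradiction)

module Real where

  -- Real numbers as Cauchy sequences of rationals; the operations are
  -- pointwise and equality is "the difference tends to zero".

  IsCauchy : (ℕ → ℚ) → Set
  IsCauchy x = ∀ ε → 0ℚ < ε → ∃[ N ] (∀ m n → m ≥ N → n ≥ N → ∣ x m - x n ∣ < ε)

  record ℝ : Set where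
    constructor mkℝ
    field
      seq    : ℕ → ℚ
      cauchy : IsCauchy seq

  open ℝ public

  infix 4 _≈_

  record _≈_ (x y : ℝ) : Set where
    constructor mk≈
    field
      converges : ∀ ε → 0ℚ < ε → ∃[ N ] (∀ n → n ≥ N → ∣ seq x n - seq y n ∣ < ε)

  open _≈_ public

  abstract
    half-pos : ∀ ε → 0ℚ < ε → 0ℚ < ½ * ε
    half-pos ε 0<ε = subst (_< ½ * ε) (ℚₚ.*-zeroʳ ½) (ℚₚ.*-monoʳ-<-pos ½ 0<ε)

    half+half : ∀ ε → ½ * ε + ½ * ε ≡ ε
    half+half ε = trans (sym (ℚₚ.*-distribʳ-+ ε ½ ½)) (ℚₚ.*-identityˡ ε)

    ∣p-p∣≡0 : ∀ p → ∣ p - p ∣ ≡ 0ℚ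
    ∣p-p∣≡0 p = cong ∣_∣ (ℚₚ.+-inverseʳ p)

    ∣p-q∣≡∣q-p∣ : ∀ p q → ∣ p - q ∣ ≡ ∣ q - p ∣
    ∣p-q∣≡∣q-p∣ p q = trans (sym (ℚₚ.∣-p∣≡∣p∣ (p - q)))
      (cong ∣_∣ (+-*-Solver.solve 2 (λ a b → :- (a :- b) := b :- a) refl p q))
      where open +-*-Solver

    ∣+∣<ε : ∀ ε p q → ∣ p ∣ < ½ * ε → ∣ q ∣ < ½ * ε → ∣ p + q ∣ < ε
    ∣+∣<ε ε p q p< q< = ℚₚ.≤-<-trans (ℚₚ.∣p+q∣≤∣p∣+∣q∣ p q)
      (subst (∣ p ∣ + ∣ q ∣ <_) (half+half ε) (ℚₚ.+-mono-< p< q<))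

    +-close : ∀ ε a b c d → ∣ a - c ∣ < ½ * ε → ∣ b - d ∣ < ½ * ε → ∣ (a + b) - (c + d) ∣ < ε
    +-close ε a b c d p q = subst (λ t → ∣ t ∣ < ε)
      (+-*-Solver.solve 4 (λ a b c d → (a :- c) :+ (b :- d) := (a :+ b) :- (c :+ d)) refl a b c d)
      (∣+∣<ε ε (a - c) (b - d) p q)
      where open +-*-Solver

    neg-close : ∀ ε a c → ∣ a - c ∣ < ε → ∣ (- a) - (- c) ∣ < ε
    neg-close ε a c p = subst (_< ε)
      (trans (∣p-q∣≡∣q-p∣ a c)
        (cong ∣_∣ (+-*-Solver.solve 2 (λ a c → c :- a := (:- a) :- (:- c)) refl a c)))
      p
      where open +-*-Solver

    ∣*∣<ε : ∀ ε A δ p q → 0ℚ < A → ∣ p ∣ ≤ A → A * δ ≡ ½ * ε → ∣ q ∣ < δ → ∣ p * q ∣ < ½ * ε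
    ∣*∣<ε ε A δ p q 0<A p≤A Aδ≡ q<δ = begin-strict
      ∣ p * q ∣     ≡⟨ ℚₚ.∣p*q∣≡∣p∣*∣q∣ p q ⟩
      ∣ p ∣ * ∣ q ∣ ≤⟨ ℚₚ.*-monoʳ-≤-nonNeg ∣ q ∣ {{ℚₚ.∣-∣-nonNeg q}} p≤A ⟩
      A * ∣ q ∣     <⟨ ℚₚ.*-monoʳ-<-pos A {{positive 0<A}} q<δ ⟩
      A * δ         ≡⟨ Aδ≡ ⟩
      ½ * ε         ∎
      where open ℚₚ.≤-Reasoning

    *-close : ∀ ε A D δ η a b c d → 0ℚ < A → 0ℚ < D → ∣ a ∣ ≤ A → ∣ d ∣ ≤ D →
              A * δ ≡ ½ * ε → D * η ≡ ½ * ε → ∣ b - d ∣ < δ → ∣ a - c ∣ < η →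
              ∣ a * b - c * d ∣ < ε
    *-close ε A D δ η a b c d 0<A 0<D a≤A d≤D Aδ Dη b-d a-c = subst (λ t → ∣ t ∣ < ε)
      (+-*-Solver.solve 4 (λ a b c d → a :* (b :- d) :+ d :* (a :- c) := a :* b :- c :* d) refl a b c d)
      (∣+∣<ε ε (a * (b - d)) (d * (a - c))
        (∣*∣<ε ε A δ a (b - d) 0<A a≤A Aδ b-d) (∣*∣<ε ε D η d (a - c) 0<D d≤D Dη a-c))
      where open +-*-Solver

    scaled : ∀ A ε → 0ℚ < A → 0ℚ < ε → ∃[ δ ] (0ℚ < δ × A * δ ≡ ½ * ε)
    scaled A ε 0<A 0<ε = δ , 0<δ , Aδ≡
      where
      instance
        A-pos : Positive A
        A-pos = positive 0<A
        A-nonZero : NonZero A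
        A-nonZero = ℚₚ.pos⇒nonZero A
        1/A-pos : Positive (1/ A)
        1/A-pos = ℚₚ.1/pos⇒pos A
      δ : ℚ
      δ = (1/ A) * (½ * ε)
      0<δ : 0ℚ < δ
      0<δ = subst (_< δ) (ℚₚ.*-zeroʳ (1/ A)) (ℚₚ.*-monoʳ-<-pos (1/ A) (half-pos ε 0<ε))
      Aδ≡ : A * δ ≡ ½ * ε
      Aδ≡ = trans (sym (ℚₚ.*-assoc A (1/ A) (½ * ε)))
        (trans (cong (_* (½ * ε)) (ℚₚ.*-inverseʳ A)) (ℚₚ.*-identityˡ (½ * ε)))

    eventually-bounded : ∀ x → ∃[ A ] (0ℚ < A × ∃[ N ] (∀ n → n ≥ N → ∣ seq x n ∣ ≤ A))
    eventually-bounded x with cauchy x 1ℚ (ℚₚ.positive⁻¹ 1ℚ)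
    ... | N , close = 1ℚ + ∣ seq x N ∣ , 0<A , N , bound
      where
      0<A : 0ℚ < 1ℚ + ∣ seq x N ∣
      0<A = ℚₚ.+-mono-<-≤ (ℚₚ.positive⁻¹ 1ℚ) (ℚₚ.0≤∣p∣ (seq x N))
      bound : ∀ n → n ≥ N → ∣ seq x n ∣ ≤ 1ℚ + ∣ seq x N ∣
      bound n n≥N = begin
        ∣ seq x n ∣                       ≡⟨ cong ∣_∣ (+-*-Solver.solve 2 (λ a b → a := (a :- b) :+ b) refl (seq x n) (seq x N)) ⟩
        ∣ (seq x n - seq x N) + seq x N ∣ ≤⟨ ℚₚ.∣p+q∣≤∣p∣+∣q∣ (seq x n - seq x N) (seq x N) ⟩
        ∣ seq x n - seq x N ∣ + ∣ seq x N ∣ ≤⟨ ℚₚ.+-monoˡ-≤ ∣ seq x N ∣ (ℚₚ.<⇒≤ (close n N n≥N ℕₚ.≤-refl)) ⟩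
        1ℚ + ∣ seq x N ∣                  ∎
        where
        open ℚₚ.≤-Reasoning
        open +-*-Solver

  ⊔ˡ : ∀ {n} a b → n ≥ a ⊔ b → n ≥ a
  ⊔ˡ a b = ℕₚ.≤-trans (ℕₚ.m≤m⊔n a b)

  ⊔ʳ : ∀ {n} a b → n ≥ a ⊔ b → n ≥ b
  ⊔ʳ a b = ℕₚ.≤-trans (ℕₚ.m≤n⊔m a b)

  fromℚ : ℚ → ℝ
  fromℚ q = mkℝ (λ _ → q) λ ε 0<ε → 0 , λ _ _ _ _ → subst (_< ε) (sym (∣p-p∣≡0 q)) 0<ε

  0ℝ 1ℝ : ℝ
  0ℝ = fromℚ 0ℚ
  1ℝ = fromℚ 1ℚ

  infixl 6 _+ℝ_
  infixl 7 _*ℝ_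
  infix  8 -ℝ_

  abstract
    +-isCauchy : ∀ x y → IsCauchy (λ n → seq x n + seq y n)
    +-isCauchy x y ε 0<ε =
      let M , p = cauchy x (½ * ε) (half-pos ε 0<ε)
          N , q = cauchy y (½ * ε) (half-pos ε 0<ε)
      in M ⊔ N , λ m n m≥ n≥ →
           +-close ε (seq x m) (seq y m) (seq x n) (seq y n)
             (p m n (⊔ˡ M N m≥) (⊔ˡ M N n≥)) (q m n (⊔ʳ M N m≥) (⊔ʳ M N n≥))

    neg-isCauchy : ∀ x → IsCauchy (λ n → - seq x n)
    neg-isCauchy x ε 0<ε = let M , p = cauchy x ε 0<ε in
      M , λ m n m≥ n≥ → neg-close ε (seq x m) (seq x n) (p m n m≥ n≥)

    *-isCauchy : ∀ x y → IsCauchy (λ n → seq x n * seq y n)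
    *-isCauchy x y ε 0<ε =
      let A , 0<A , K , x≤A = eventually-bounded x
          D , 0<D , L , y≤D = eventually-bounded y
          δ , 0<δ , Aδ = scaled A ε 0<A 0<ε
          η , 0<η , Dη = scaled D ε 0<D 0<ε
          M , p = cauchy y δ 0<δ
          N , q = cauchy x η 0<η
      in (K ⊔ L) ⊔ (M ⊔ N) , λ m n m≥ n≥ →
           *-close ε A D δ η (seq x m) (seq y m) (seq x n) (seq y n) 0<A 0<D
             (x≤A m (⊔ˡ K L (⊔ˡ (K ⊔ L) (M ⊔ N) m≥)))
             (y≤D n (⊔ʳ K L (⊔ˡ (K ⊔ L) (M ⊔ N) n≥)))
             Aδ Dη
             (p m n (⊔ˡ M N (⊔ʳ (K ⊔ L) (M ⊔ N) m≥)) (⊔ˡ M N (⊔ʳ (K ⊔ L) (M ⊔ N) n≥)))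
             (q m n (⊔ʳ M N (⊔ʳ (K ⊔ L) (M ⊔ N) m≥)) (⊔ʳ M N (⊔ʳ (K ⊔ L) (M ⊔ N) n≥)))

  _+ℝ_ _*ℝ_ : ℝ → ℝ → ℝ
  x +ℝ y = mkℝ (λ n → seq x n + seq y n) (+-isCauchy x y)
  x *ℝ y = mkℝ (λ n → seq x n * seq y n) (*-isCauchy x y)

  -ℝ_ : ℝ → ℝ
  -ℝ x = mkℝ (λ n → - seq x n) (neg-isCauchy x)

  abstract
    pointwise⇒≈ : ∀ {x y} → (∀ n → seq x n ≡ seq y n) → x ≈ y
    pointwise⇒≈ {x} {y} eq = mk≈ λ ε 0<ε → 0 , λ n _ →
      subst (_< ε) (sym (trans (cong (λ t → ∣ t - seq y n ∣) (eq n)) (∣p-p∣≡0 (seq y n)))) 0<ε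

    ≈-refl : ∀ {x} → x ≈ x
    ≈-refl = pointwise⇒≈ λ _ → refl

    ≈-sym : ∀ {x y} → x ≈ y → y ≈ x
    ≈-sym {x} {y} x≈y = mk≈ λ ε 0<ε → let N , p = converges x≈y ε 0<ε in
      N , λ n n≥ → subst (_< ε) (∣p-q∣≡∣q-p∣ (seq x n) (seq y n)) (p n n≥)

    ≈-trans : ∀ {x y z} → x ≈ y → y ≈ z → x ≈ z
    ≈-trans {x} {y} {z} x≈y y≈z = mk≈ λ ε 0<ε →
      let M , p = converges x≈y (½ * ε) (half-pos ε 0<ε)
          N , q = converges y≈z (½ * ε) (half-pos ε 0<ε)
      in M ⊔ N , λ n n≥ → subst (λ t → ∣ t ∣ < ε)
           (+-*-Solver.solve 3 (λ a b c → (a :- b) :+ (b :- c) := a :- c) refl (seq x n) (seq y n) (seq z n))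
           (∣+∣<ε ε (seq x n - seq y n) (seq y n - seq z n) (p n (⊔ˡ M N n≥)) (q n (⊔ʳ M N n≥)))
      where open +-*-Solver

    +ℝ-cong : ∀ {x y u v} → x ≈ y → u ≈ v → x +ℝ u ≈ y +ℝ v
    +ℝ-cong {x} {y} {u} {v} x≈y u≈v = mk≈ λ ε 0<ε →
      let M , p = converges x≈y (½ * ε) (half-pos ε 0<ε)
          N , q = converges u≈v (½ * ε) (half-pos ε 0<ε)
      in M ⊔ N , λ n n≥ →
           +-close ε (seq x n) (seq u n) (seq y n) (seq v n) (p n (⊔ˡ M N n≥)) (q n (⊔ʳ M N n≥))

    -ℝ-cong : ∀ {x y} → x ≈ y → -ℝ x ≈ -ℝ y
    -ℝ-cong {x} {y} x≈y = mk≈ λ ε 0<ε → let N , p = converges x≈y ε 0<ε in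
      N , λ n n≥ → neg-close ε (seq x n) (seq y n) (p n n≥)

    *ℝ-cong : ∀ {x y u v} → x ≈ y → u ≈ v → x *ℝ u ≈ y *ℝ v
    *ℝ-cong {x} {y} {u} {v} x≈y u≈v = mk≈ λ ε 0<ε →
      let A , 0<A , K , x≤A = eventually-bounded x
          D , 0<D , L , v≤D = eventually-bounded v
          δ , 0<δ , Aδ = scaled A ε 0<A 0<ε
          η , 0<η , Dη = scaled D ε 0<D 0<ε
          M , p = converges u≈v δ 0<δ
          N , q = converges x≈y η 0<η
      in (K ⊔ L) ⊔ (M ⊔ N) , λ n n≥ →
           *-close ε A D δ η (seq x n) (seq u n) (seq y n) (seq v n) 0<A 0<D
             (x≤A n (⊔ˡ K L (⊔ˡ (K ⊔ L) (M ⊔ N) n≥)))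
             (v≤D n (⊔ʳ K L (⊔ˡ (K ⊔ L) (M ⊔ N) n≥)))
             Aδ Dη
             (p n (⊔ˡ M N (⊔ʳ (K ⊔ L) (M ⊔ N) n≥)))
             (q n (⊔ʳ M N (⊔ʳ (K ⊔ L) (M ⊔ N) n≥)))

  ℝ-commutativeRing : CommutativeRing 0ℓ 0ℓ
  ℝ-commutativeRing = record
    { Carrier = ℝ
    ; _≈_ = _≈_
    ; _+_ = _+ℝ_
    ; _*_ = _*ℝ_
    ; -_  = -ℝ_
    ; 0#  = 0ℝ
    ; 1#  = 1ℝ
    ; isCommutativeRing = record
      { isRing = record
        { +-isAbelianGroup = record
          { isGroup = record
            { isMonoid = record
              { isSemigroup = record
                { isMagma = record
                  { isEquivalence = record { refl = ≈-refl ; sym = ≈-sym ; trans = ≈-trans }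
                  ; ∙-cong = +ℝ-cong
                  }
                ; assoc = λ x y z → pointwise⇒≈ λ n → ℚₚ.+-assoc (seq x n) (seq y n) (seq z n)
                }
              ; identity = (λ x → pointwise⇒≈ λ n → ℚₚ.+-identityˡ (seq x n))
                         , (λ x → pointwise⇒≈ λ n → ℚₚ.+-identityʳ (seq x n))
              }
            ; inverse = (λ x → pointwise⇒≈ λ n → ℚₚ.+-inverseˡ (seq x n))
                      , (λ x → pointwise⇒≈ λ n → ℚₚ.+-inverseʳ (seq x n))
            ; ⁻¹-cong = -ℝ-cong
            }
          ; comm = λ x y → pointwise⇒≈ λ n → ℚₚ.+-comm (seq x n) (seq y n)
          }
        ; *-cong = *ℝ-cong
        ; *-assoc = λ x y z → pointwise⇒≈ λ n → ℚₚ.*-assoc (seq x n) (seq y n) (seq z n)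
        ; *-identity = (λ x → pointwise⇒≈ λ n → ℚₚ.*-identityˡ (seq x n))
                     , (λ x → pointwise⇒≈ λ n → ℚₚ.*-identityʳ (seq x n))
        ; distrib = (λ x y z → pointwise⇒≈ λ n → ℚₚ.*-distribˡ-+ (seq x n) (seq y n) (seq z n))
                  , (λ x y z → pointwise⇒≈ λ n → ℚₚ.*-distribʳ-+ (seq x n) (seq y n) (seq z n))
        }
      ; *-comm = λ x y → pointwise⇒≈ λ n → ℚₚ.*-comm (seq x n) (seq y n)
      }
    }

record Graph : Set where
  field
    order  : ℕ
    adj    : Fin order → Fin order → Bool
    symm   : ∀ u v → adj u v ≡ adj v u
    irrefl : ∀ v → adj v v ≡ false

  Vertex : Set
  Vertex = Fin order

  neighbours : Vertex → Subset order
  neighbours v = tabulate (adj v)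

  degree : Vertex → ℕ
  degree v = Subset.∣ neighbours v ∣

open Graph public

distinct : ∀ {n} → Fin n → Fin n → Bool
distinct u v = not ⌊ u ≟ v ⌋

distinct-sym : ∀ {n} (u v : Fin n) → distinct u v ≡ distinct v u
distinct-sym u v with u ≟ v | v ≟ u
... | yes _   | yes _   = refl
... | no _    | no _    = refl
... | yes u≡v | no v≢u  = contradiction (sym u≡v) v≢u
... | no u≢v  | yes v≡u = contradiction (sym v≡u) u≢v

distinct-irrefl : ∀ {n} (v : Fin n) → distinct v v ≡ false
distinct-irrefl v with v ≟ v
... | yes _  = refl
... | no v≢v = contradiction refl v≢v

K : ℕ → Graph
K n = record
  { order  = n
  ; adj    = distinct
  ; symm   = distinct-sym
  ; irrefl = distinct-irrefl
  }

complement : Graph → Graph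
complement G = record
  { order  = order G
  ; adj    = λ u v → distinct u v ∧ not (adj G u v)
  ; symm   = λ u v → cong₂ _∧_ (distinct-sym u v) (cong not (symm G u v))
  ; irrefl = λ v → cong (_∧ not (adj G v v)) (distinct-irrefl v)
  }

infixr 6 _∪_

_∪_ : Graph → Graph → Graph
G ∪ H = record
  { order  = order G ℕ.+ order H
  ; adj    = λ u v → adj⊎ (splitAt (order G) u) (splitAt (order G) v)
  ; symm   = λ u v → symm⊎ (splitAt (order G) u) (splitAt (order G) v)
  ; irrefl = λ v → irrefl⊎ (splitAt (order G) v)
  }
  where
  adj⊎ : Vertex G ⊎ Vertex H → Vertex G ⊎ Vertex H → Bool
  adj⊎ (inj₁ u) (inj₁ v) = adj G u v
  adj⊎ (inj₂ u) (inj₂ v) = adj H u v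
  adj⊎ (inj₁ _) (inj₂ _) = false
  adj⊎ (inj₂ _) (inj₁ _) = false

  symm⊎ : ∀ u v → adj⊎ u v ≡ adj⊎ v u
  symm⊎ (inj₁ u) (inj₁ v) = symm G u v
  symm⊎ (inj₂ u) (inj₂ v) = symm H u v
  symm⊎ (inj₁ _) (inj₂ _) = refl
  symm⊎ (inj₂ _) (inj₁ _) = refl

  irrefl⊎ : ∀ v → adj⊎ v v ≡ false
  irrefl⊎ (inj₁ v) = irrefl G v
  irrefl⊎ (inj₂ v) = irrefl H v

-- The left fold unfolds to
--   C(α₁)      = complement (K α₁)
--   C(α₁,…,αᵢ) = complement (C(α₁,…,αᵢ₋₁) ∪ K αᵢ).
C : List⁺ ℕ → Graph
C (α₁ ∷ αs) = List.foldl (λ G α → complement (G ∪ K α)) (complement (K α₁)) αs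

module LinearAlgebra {c ℓ} (R : CommutativeRing c ℓ) where
  private module R = CommutativeRing R
  open import Algebra.Definitions.RawMonoid R.+-rawMonoid using (sum) renaming (_×_ to _×#_)

  Matrix : ℕ → Set c
  Matrix n = Fin n → Fin n → R.Carrier

  infixr 7 _·_

  _·_ : ∀ {n} → Matrix n → Vector R.Carrier n → Vector R.Carrier n
  (M · v) i = sum (λ j → M i j R.* v j)

  IsEigenvalue : ∀ {n} → Matrix n → R.Carrier → Set (c ⊔ˡ ℓ)
  IsEigenvalue {n} M x = Σ (Vector R.Carrier n) λ v →
    (¬ (∀ i → v i R.≈ R.0#)) × (∀ i → (M · v) i R.≈ x R.* v i)

  adjacencyMatrix degreeMatrix laplacian : (G : Graph) → Matrix (order G)
  adjacencyMatrix G u v = if adj G u v then R.1# else R.0#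
  degreeMatrix    G u v = if ⌊ u ≟ v ⌋ then degree G u ×# R.1# else R.0#
  laplacian       G u v = degreeMatrix G u v R.- adjacencyMatrix G u v

  eigenvalueSetoid : ∀ {n} → Matrix n → Setoid (c ⊔ˡ ℓ) ℓ
  eigenvalueSetoid M = record
    { Carrier       = ∃ (IsEigenvalue M)
    ; _≈_           = λ x y → proj₁ x R.≈ proj₁ y
    ; isEquivalence = record { refl = R.refl ; sym = R.sym ; trans = R.trans }
    }

open LinearAlgebra Real.ℝ-commutativeRing public

-- m(G) = n: the real Laplacian eigenvalues of G, counted up to equality
-- in ℝ and without multiplicity, are in bijection with Fin n.
DistinctLaplacianEigenvalues : Graph → ℕ → Set
DistinctLaplacianEigenvalues G n = Bijection (setoid (Fin n)) (eigenvalueSetoid (laplacian G))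

{-# OPTIONS --safe #-}
module Submission where

-- The eigenvalues of C(p,…,p) with k ≥ 2 entries are exactly the multiples j p with 0 ≤ j ≤ k.
-- On vectors of sum zero the Laplacians of a graph on n vertices and of its complement add up to n,
-- and the Laplacian of a disjoint union is block diagonal.  Passing from k - 1 to k entries
-- therefore sends each nonzero eigenvalue x to k p - x, and adds k p (from the vector that is
-- constant on both parts of the union) and (k - 1) p (from the clique K p, where p ≥ 2 is needed).
-- Conversely, if x is none of these values, every eigenvector for x vanishes, by induction on k.
-- This only shows that x cannot differ from all the j p; since equality of reals is ¬¬-stable and
-- the j p are distinct integers, a rational approximation of x then determines j.

open import Defs
open import Algebra.Bundles using (CommutativeRing)
open import Data.Bool.Base using (Bool; true; false; if_then_else_)
open import Data.Fin.Base using (Fin; zero; suc; toℕ; fromℕ<; splitAt; join; _↑ˡ_; _↑ʳ_)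
open import Data.Fin.Properties using (_≟_; splitAt-↑ˡ; splitAt-↑ʳ; join-splitAt; toℕ-fromℕ<; toℕ-injective; toℕ<n)
import Data.Fin.Subset as Subset
import Data.List.Base as List
open import Data.List.NonEmpty using (replicate; _∷_)
open import Data.Nat.Base using (ℕ; zero; suc; _≤_; _<_; _∸_; z≤n; s≤s; s≤s⁻¹; z<s; NonZero; >-nonZero)
import Data.Nat.Base as ℕ
open import Data.Nat.Divisibility using (_∣_)
open import Data.Nat.Properties using (m<n⇒n≢0)
import Data.Nat.Properties as ℕₚ
open import Data.Product.Base using (Σ; ∃; ∃-syntax; _×_; _,_; proj₁)
open import Data.Rational.Base as ℚ using (ℚ; 0ℚ; 1ℚ; ½; ∣_∣)
import Data.Rational.Properties as ℚₚ
open import Data.Rational.Solver using (module +-*-Solver)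
open import Data.Sum.Base using (_⊎_; inj₁; inj₂)
open import Data.Vec.Base using (tabulate)
open import Data.Vec.Functional using (Vector; _++_)
open import Data.Vec.Functional.Properties using (lookup-++ˡ; lookup-++ʳ)
open import Function.Base using (_∘_)
open import Level using () renaming (_⊔_ to _⊔ˡ_)
open import Relation.Binary.PropositionalEquality as ≡ using (_≡_; _≢_)
open import Relation.Nullary.Decidable using (⌊_⌋; yes; no)
open import Relation.Nullary.Negation using (¬_; contradiction)

-- The graph with all entries equal to `p`, as a recursion on the number of entries.

tower : ℕ → ℕ → Graph
tower p zero    = complement (K p)
tower p (suc m) = complement (tower p m ∪ K p)

order-tower : ∀ p m → order (tower p m) ≡ suc m ℕ.* p
order-tower p zero    = ≡.sym (ℕₚ.*-identityˡ p)
order-tower p (suc m) = ≡.trans (≡.cong (ℕ._+ p) (order-tower p m)) (ℕₚ.+-comm (suc m ℕ.* p) p)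

-- `List.foldl` takes its extra step first, whereas `tower` takes it last; with all entries equal
-- the two agree.
foldl-replicate : ∀ {a b} {A : Set a} {B : Set b} (f : B → A → B) x n y →
                  List.foldl f (f y x) (List.replicate n x) ≡ f (List.foldl f y (List.replicate n x)) x
foldl-replicate f x zero    y = ≡.refl
foldl-replicate f x (suc n) y = foldl-replicate f x n (f y x)

C-replicate≡tower : ∀ p m → C (p ∷ List.replicate m p) ≡ tower p m
C-replicate≡tower p zero    = ≡.refl
C-replicate≡tower p (suc m) = ≡.trans (foldl-replicate (λ G α → complement (G ∪ K α)) p m (complement (K p)))
  (≡.cong (λ G → complement (G ∪ K p)) (C-replicate≡tower p m))

-- Finite sums over a commutative ring.

module LaplacianOperator {c ℓ} (R : CommutativeRing c ℓ) where

  open CommutativeRing R hiding (zero)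
  open import Algebra.Properties.Semiring.Sum semiring using (sum; sum-cong-≋; sum-replicate; sum-replicate-zero; ∑-distrib-+; ∑-comm; *-distribˡ-sum; *-distribʳ-sum)
  open import Algebra.Properties.Semiring.Mult semiring using (×-congˡ; ×-congʳ; ×-homo-+; ×-assoc-*) renaming (_×_ to _×#_)
  open import Algebra.Properties.Ring ring using (-0#≈0#; -‿+-comm; -‿distribʳ-*; x[y-z]≈xy-xz; [y-z]x≈yx-zx; x∙y⁻¹≈ε⇒x≈y; x≈y⇒x∙y⁻¹≈ε; +-cancelˡ; +-cancelʳ)
  open import Relation.Binary.Reasoning.Setoid setoid

  private
    module L = LinearAlgebra R

  ⟦_⟧ : ℕ → Carrier
  ⟦ n ⟧ = n ×# 1#

  Δ : (G : Graph) → Vector Carrier (order G) → Vector Carrier (order G)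
  Δ G v = L.laplacian G L.· v

  IsEigenvector : (G : Graph) → Carrier → Vector Carrier (order G) → Set ℓ
  IsEigenvector G x v = ∀ i → Δ G v i ≈ x * v i

  x-0≈x : ∀ x → x - 0# ≈ x
  x-0≈x x = trans (+-congˡ -0#≈0#) (+-identityʳ x)

  sum-zero : ∀ {n} {f : Vector Carrier n} → (∀ i → f i ≈ 0#) → sum f ≈ 0#
  sum-zero {n} f≈0 = trans (sum-cong-≋ f≈0) (sum-replicate-zero n)

  sum-neg : ∀ {n} (f : Vector Carrier n) → sum (λ i → - f i) ≈ - sum f
  sum-neg {zero}  f = sym -0#≈0#
  sum-neg {suc n} f = trans (+-congˡ (sum-neg (f ∘ suc))) (-‿+-comm _ _)

  sum-sub : ∀ {n} (f g : Vector Carrier n) → sum (λ i → f i - g i) ≈ sum f - sum g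
  sum-sub f g = trans (∑-distrib-+ f (λ i → - g i)) (+-congˡ (sum-neg g))

  sum-const : ∀ n x → sum {n} (λ _ → x) ≈ ⟦ n ⟧ * x
  sum-const n x = begin
    sum {n} (λ _ → x) ≈⟨ sum-replicate n ⟩
    n ×# x            ≈⟨ ×-congʳ n (*-identityˡ x) ⟨
    n ×# (1# * x)     ≈⟨ ×-assoc-* n 1# x ⟨
    ⟦ n ⟧ * x         ∎

  sum-↑ : ∀ m {n} (f : Vector Carrier (m ℕ.+ n)) → sum f ≈ sum (λ i → f (i ↑ˡ n)) + sum (λ j → f (m ↑ʳ j))
  sum-↑ zero    f = sym (+-identityˡ _)
  sum-↑ (suc m) f = trans (+-congˡ (sum-↑ m (f ∘ suc))) (sym (+-assoc _ _ _))

  sum-δ : ∀ {n} (i : Fin n) x (v : Vector Carrier n) →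
          sum (λ j → (if ⌊ i ≟ j ⌋ then x else 0#) * v j) ≈ x * v i
  sum-δ zero    x v = trans (+-congˡ (sum-zero λ j → zeroˡ (v (suc j)))) (+-identityʳ _)
  sum-δ (suc i) x v = trans (+-cong (zeroˡ _) (trans (sum-cong-≋ shift) (sum-δ i x (v ∘ suc)))) (+-identityˡ _)
    where
    shift : ∀ j → (if ⌊ suc i ≟ suc j ⌋ then x else 0#) * v (suc j) ≈ (if ⌊ i ≟ j ⌋ then x else 0#) * v (suc j)
    shift j with i ≟ j
    ... | yes _ = refl
    ... | no  _ = refl

  count-tabulate : ∀ {n} (f : Fin n → Bool) → ⟦ Subset.∣ tabulate f ∣ ⟧ ≈ sum (λ j → if f j then 1# else 0#)
  count-tabulate {zero}  f = refl
  count-tabulate {suc n} f with f zero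
  ... | true  = +-congˡ (count-tabulate (f ∘ suc))
  ... | false = trans (count-tabulate (f ∘ suc)) (sym (+-identityˡ _))

  -- Laplacians of complete graphs, complements and disjoint unions.

  Δ-differences : ∀ G v i → Δ G v i ≈ sum (λ j → L.adjacencyMatrix G i j * (v i - v j))
  Δ-differences G v i = begin
    sum (λ j → (D j - A j) * v j)                   ≈⟨ sum-cong-≋ (λ j → [y-z]x≈yx-zx (v j) (D j) (A j)) ⟩
    sum (λ j → D j * v j - A j * v j)               ≈⟨ sum-sub (λ j → D j * v j) (λ j → A j * v j) ⟩
    sum (λ j → D j * v j) - sum (λ j → A j * v j)   ≈⟨ +-congʳ (sum-δ i ⟦ degree G i ⟧ v) ⟩
    -- The degree is a row sum of the adjacency matrix, so the diagonal term is spread over the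
    -- neighbours of `i`.
    ⟦ degree G i ⟧ * v i - sum (λ j → A j * v j)    ≈⟨ +-congʳ (*-congʳ (count-tabulate (adj G i))) ⟩
    sum A * v i - sum (λ j → A j * v j)             ≈⟨ +-congʳ (*-distribʳ-sum (v i) A) ⟩
    sum (λ j → A j * v i) - sum (λ j → A j * v j)   ≈⟨ sum-sub (λ j → A j * v i) (λ j → A j * v j) ⟨
    sum (λ j → A j * v i - A j * v j)               ≈⟨ sum-cong-≋ (λ j → x[y-z]≈xy-xz (A j) (v i) (v j)) ⟨
    sum (λ j → A j * (v i - v j))                   ∎
    where
    D A : Vector Carrier (order G)
    D = L.degreeMatrix G i
    A = L.adjacencyMatrix G i

  -- Adjacency is symmetric, so the differences for `(i, j)` and `(j, i)` cancel in the double sum.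
  sum-Δ : ∀ G v → sum (Δ G v) ≈ 0#
  sum-Δ G v = begin
    sum (Δ G v)                                                             ≈⟨ sum-cong-≋ (Δ-differences G v) ⟩
    sum (λ i → sum (λ j → A i j * (v i - v j)))                             ≈⟨ sum-cong-≋ (λ i → sum-cong-≋ (λ j → x[y-z]≈xy-xz (A i j) (v i) (v j))) ⟩
    sum (λ i → sum (λ j → A i j * v i - A i j * v j))                       ≈⟨ sum-cong-≋ (λ i → sum-sub (λ j → A i j * v i) (λ j → A i j * v j)) ⟩
    sum (λ i → sum (λ j → A i j * v i) - sum (λ j → A i j * v j))           ≈⟨ sum-sub (λ i → sum (λ j → A i j * v i)) (λ i → sum (λ j → A i j * v j)) ⟩
    sum (λ i → sum (λ j → A i j * v i)) - sum (λ i → sum (λ j → A i j * v j)) ≈⟨ x≈y⇒x∙y⁻¹≈ε symmetric ⟩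
    0#                                                                      ∎
    where
    A : Fin (order G) → Fin (order G) → Carrier
    A = L.adjacencyMatrix G
    symmetric : sum (λ i → sum (λ j → A i j * v i)) ≈ sum (λ i → sum (λ j → A i j * v j))
    symmetric = begin
      sum (λ i → sum (λ j → A i j * v i)) ≈⟨ ∑-comm (λ i j → A i j * v i) ⟩
      sum (λ j → sum (λ i → A i j * v i)) ≈⟨ sum-cong-≋ (λ j → sum-cong-≋ (λ i → *-congʳ (reflexive (≡.cong (if_then 1# else 0#) (symm G i j))))) ⟩
      sum (λ j → sum (λ i → A j i * v i)) ∎

  sum-differences : ∀ {n} (v : Vector Carrier n) i → sum (λ j → v i - v j) ≈ ⟦ n ⟧ * v i - sum v
  sum-differences {n} v i = trans (sum-sub (λ _ → v i) v) (+-congʳ (sum-const n (v i)))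

  Δ-K : ∀ n v i → Δ (K n) v i ≈ ⟦ n ⟧ * v i - sum v
  Δ-K n v i = trans (Δ-differences (K n) v i) (trans (sum-cong-≋ term) (sum-differences v i))
    where
    term : ∀ j → L.adjacencyMatrix (K n) i j * (v i - v j) ≈ v i - v j
    term j with i ≟ j
    ... | yes ≡.refl = trans (zeroˡ _) (sym (-‿inverseʳ (v i)))
    ... | no  _      = *-identityˡ _

  -- Two distinct vertices are adjacent in exactly one of the two graphs, and the term `j = i` is
  -- zero, so together they give every difference `v i - v j` once.
  Δ-complement : ∀ G v i → Δ (complement G) v i + Δ G v i ≈ ⟦ order G ⟧ * v i - sum v
  Δ-complement G v i = begin
    Δ (complement G) v i + Δ G v i                            ≈⟨ +-cong (Δ-differences (complement G) v i) (Δ-differences G v i) ⟩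
    sum (λ j → A′ j * (v i - v j)) + sum (λ j → A j * (v i - v j)) ≈⟨ ∑-distrib-+ (λ j → A′ j * (v i - v j)) (λ j → A j * (v i - v j)) ⟨
    sum (λ j → A′ j * (v i - v j) + A j * (v i - v j))        ≈⟨ sum-cong-≋ term ⟩
    sum (λ j → v i - v j)                                     ≈⟨ sum-differences v i ⟩
    ⟦ order G ⟧ * v i - sum v                                 ∎
    where
    A A′ : Vector Carrier (order G)
    A  = L.adjacencyMatrix G i
    A′ = L.adjacencyMatrix (complement G) i
    term : ∀ j → A′ j * (v i - v j) + A j * (v i - v j) ≈ v i - v j
    term j with i ≟ j
    ... | yes ≡.refl = trans (+-cong (zeroˡ _) (trans (*-congˡ (-‿inverseʳ (v i))) (zeroʳ _)))
                             (trans (+-identityʳ 0#) (sym (-‿inverseʳ (v i))))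
    ... | no _ with adj G i j
    ...   | true  = trans (+-cong (zeroˡ _) (*-identityˡ _)) (+-identityˡ _)
    ...   | false = trans (+-cong (*-identityˡ _) (zeroˡ _)) (+-identityʳ _)

  Δ-edgeless : ∀ n v i → Δ (complement (K n)) v i ≈ 0#
  Δ-edgeless n v i = +-cancelʳ (Δ (K n) v i) _ _ (begin
    Δ (complement (K n)) v i + Δ (K n) v i ≈⟨ Δ-complement (K n) v i ⟩
    ⟦ n ⟧ * v i - sum v                    ≈⟨ Δ-K n v i ⟨
    Δ (K n) v i                            ≈⟨ +-identityˡ _ ⟨
    0# + Δ (K n) v i                       ∎)

  -- No edge joins the two parts, so the differences across them have coefficient zero.
  Δ-∪ˡ : ∀ G H v i → Δ (G ∪ H) v (i ↑ˡ order H) ≈ Δ G (λ j → v (j ↑ˡ order H)) i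
  Δ-∪ˡ G H v i = begin
    Δ (G ∪ H) v i′                                       ≈⟨ Δ-differences (G ∪ H) v i′ ⟩
    sum f                                                ≈⟨ sum-↑ (order G) f ⟩
    sum (λ j → f (j ↑ˡ h)) + sum (λ j → f (order G ↑ʳ j)) ≈⟨ +-cong (sum-cong-≋ inside) (sum-zero across) ⟩
    sum (λ j → L.adjacencyMatrix G i j * (v i′ - v (j ↑ˡ h))) + 0# ≈⟨ +-identityʳ _ ⟩
    sum (λ j → L.adjacencyMatrix G i j * (v i′ - v (j ↑ˡ h))) ≈⟨ Δ-differences G _ i ⟨
    Δ G (λ j → v (j ↑ˡ h)) i                             ∎
    where
    h = order H
    i′ = i ↑ˡ h
    f : Vector Carrier (order (G ∪ H))
    f j = L.adjacencyMatrix (G ∪ H) i′ j * (v i′ - v j)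
    inside : ∀ j → f (j ↑ˡ h) ≈ L.adjacencyMatrix G i j * (v i′ - v (j ↑ˡ h))
    inside j rewrite splitAt-↑ˡ (order G) i h | splitAt-↑ˡ (order G) j h = refl
    across : ∀ j → f (order G ↑ʳ j) ≈ 0#
    across j rewrite splitAt-↑ˡ (order G) i h | splitAt-↑ʳ (order G) h j = zeroˡ _

  Δ-∪ʳ : ∀ G H v i → Δ (G ∪ H) v (order G ↑ʳ i) ≈ Δ H (λ j → v (order G ↑ʳ j)) i
  Δ-∪ʳ G H v i = begin
    Δ (G ∪ H) v i′                                       ≈⟨ Δ-differences (G ∪ H) v i′ ⟩
    sum f                                                ≈⟨ sum-↑ g f ⟩
    sum (λ j → f (j ↑ˡ order H)) + sum (λ j → f (g ↑ʳ j)) ≈⟨ +-cong (sum-zero across) (sum-cong-≋ inside) ⟩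
    0# + sum (λ j → L.adjacencyMatrix H i j * (v i′ - v (g ↑ʳ j))) ≈⟨ +-identityˡ _ ⟩
    sum (λ j → L.adjacencyMatrix H i j * (v i′ - v (g ↑ʳ j))) ≈⟨ Δ-differences H _ i ⟨
    Δ H (λ j → v (g ↑ʳ j)) i                             ∎
    where
    g = order G
    i′ = g ↑ʳ i
    f : Vector Carrier (order (G ∪ H))
    f j = L.adjacencyMatrix (G ∪ H) i′ j * (v i′ - v j)
    inside : ∀ j → f (g ↑ʳ j) ≈ L.adjacencyMatrix H i j * (v i′ - v (g ↑ʳ j))
    inside j rewrite splitAt-↑ʳ g (order H) i | splitAt-↑ʳ g (order H) j = refl
    across : ∀ j → f (j ↑ˡ order H) ≈ 0#
    across j rewrite splitAt-↑ʳ g (order H) i | splitAt-↑ˡ g j (order H) = zeroˡ _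

  -- Eigenvectors under complement and disjoint union.

  sum-eigenvector : ∀ {G x v} → IsEigenvector G x v → x * sum v ≈ 0#
  sum-eigenvector {G} {x} {v} eig = begin
    x * sum v         ≈⟨ *-distribˡ-sum x v ⟩
    sum (λ i → x * v i) ≈⟨ sum-cong-≋ eig ⟨
    sum (Δ G v)       ≈⟨ sum-Δ G v ⟩
    0#                ∎

  Δ-cong : ∀ G {u v} → (∀ i → u i ≈ v i) → ∀ i → Δ G u i ≈ Δ G v i
  Δ-cong G u≈v i = sum-cong-≋ λ j → *-congˡ (u≈v j)

  -- Serves both directions: once one of the two Laplacians is known to act on `v` as its scalar,
  -- cancellation gives the other.
  complement-balance : ∀ G {x y v} → x + y ≈ ⟦ order G ⟧ → sum v ≈ 0# →
                       ∀ i → Δ (complement G) v i + Δ G v i ≈ y * v i + x * v i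
  complement-balance G {x} {y} {v} x+y≈n s≈0 i = begin
    Δ (complement G) v i + Δ G v i ≈⟨ Δ-complement G v i ⟩
    ⟦ order G ⟧ * v i - sum v      ≈⟨ +-congˡ (-‿cong s≈0) ⟩
    ⟦ order G ⟧ * v i - 0#         ≈⟨ x-0≈x _ ⟩
    ⟦ order G ⟧ * v i              ≈⟨ *-congʳ x+y≈n ⟨
    (x + y) * v i                  ≈⟨ *-congʳ (+-comm x y) ⟩
    (y + x) * v i                  ≈⟨ distribʳ (v i) y x ⟩
    y * v i + x * v i              ∎

  ∪-elim : ∀ {p} G H {P : Vertex (G ∪ H) → Set p} →
           (∀ i → P (i ↑ˡ order H)) → (∀ j → P (order G ↑ʳ j)) → ∀ i → P i
  ∪-elim G H {P} l r i = ≡.subst P (join-splitAt (order G) (order H) i) (side (splitAt (order G) i))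
    where
    side : ∀ s → P (join (order G) (order H) s)
    side (inj₁ j) = l j
    side (inj₂ j) = r j

  -- Sum zero means orthogonality to the constant vectors, the condition under which an eigenvector
  -- of a graph is also one of its complement.
  BalancedEigenvalue : Graph → Carrier → Set (c ⊔ˡ ℓ)
  BalancedEigenvalue G x = Σ (Vector Carrier (order G)) λ v →
    (¬ (∀ i → v i ≈ 0#)) × sum v ≈ 0# × IsEigenvector G x v

  balanced⇒eigenvalue : ∀ {G x} → BalancedEigenvalue G x → L.IsEigenvalue (L.laplacian G) x
  balanced⇒eigenvalue (v , v≉0 , _ , eig) = v , v≉0 , eig

  balanced-complement : ∀ {G x y} → x + y ≈ ⟦ order G ⟧ → BalancedEigenvalue G x → BalancedEigenvalue (complement G) y
  balanced-complement {G} {x} {y} x+y≈n (v , v≉0 , s≈0 , eig) = v , v≉0 , s≈0 , λ i →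
    +-cancelʳ (Δ G v i) _ _ (trans (complement-balance G x+y≈n s≈0 i) (+-congˡ (sym (eig i))))

  sum-++ : ∀ {m n} (u : Vector Carrier m) (w : Vector Carrier n) → sum (u ++ w) ≈ sum u + sum w
  sum-++ {m} u w = trans (sum-↑ m (u ++ w))
    (+-cong (sum-cong-≋ (λ i → reflexive (lookup-++ˡ u w i))) (sum-cong-≋ (λ j → reflexive (lookup-++ʳ u w j))))

  eigenvector-++ : ∀ G H {x u w} → IsEigenvector G x u → IsEigenvector H x w → IsEigenvector (G ∪ H) x (u ++ w)
  eigenvector-++ G H {x} {u} {w} eu ew = ∪-elim G H
    (λ i → begin
      Δ (G ∪ H) (u ++ w) (i ↑ˡ order H) ≈⟨ Δ-∪ˡ G H (u ++ w) i ⟩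
      Δ G _ i                           ≈⟨ Δ-cong G (λ j → reflexive (lookup-++ˡ u w j)) i ⟩
      Δ G u i                           ≈⟨ eu i ⟩
      x * u i                           ≈⟨ *-congˡ (reflexive (lookup-++ˡ u w i)) ⟨
      x * (u ++ w) (i ↑ˡ order H)       ∎)
    (λ i → begin
      Δ (G ∪ H) (u ++ w) (order G ↑ʳ i) ≈⟨ Δ-∪ʳ G H (u ++ w) i ⟩
      Δ H _ i                           ≈⟨ Δ-cong H (λ j → reflexive (lookup-++ʳ u w j)) i ⟩
      Δ H w i                           ≈⟨ ew i ⟩
      x * w i                           ≈⟨ *-congˡ (reflexive (lookup-++ʳ u w i)) ⟨
      x * (u ++ w) (order G ↑ʳ i)       ∎)

  constant-eigenvector : ∀ G x → IsEigenvector G 0# (λ _ → x)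
  constant-eigenvector G x i = begin
    Δ G (λ _ → x) i                                ≈⟨ Δ-differences G (λ _ → x) i ⟩
    sum (λ j → L.adjacencyMatrix G i j * (x - x))  ≈⟨ sum-zero (λ j → trans (*-congˡ {L.adjacencyMatrix G i j} (-‿inverseʳ x)) (zeroʳ _)) ⟩
    0#                                             ≈⟨ zeroˡ x ⟨
    0# * x                                         ∎

  zero-eigenvector : ∀ G x → IsEigenvector G x (λ _ → 0#)
  zero-eigenvector G x i = trans (constant-eigenvector G 0# i) (trans (zeroˡ 0#) (sym (zeroʳ x)))

  -- Extension by zero: the zero vector satisfies the eigenvalue equation for every `x` and leaves
  -- the sum unchanged.
  balanced-∪ˡ : ∀ {G H x} → BalancedEigenvalue G x → BalancedEigenvalue (G ∪ H) x
  balanced-∪ˡ {G} {H} {x} (v , v≉0 , s≈0 , eig) = v ++ w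
    , (λ z → v≉0 λ i → trans (reflexive (≡.sym (lookup-++ˡ v w i))) (z (i ↑ˡ order H)))
    , trans (sum-++ v w) (trans (+-cong s≈0 (sum-replicate-zero (order H))) (+-identityʳ 0#))
    , eigenvector-++ G H eig (zero-eigenvector H x)
    where
    w : Vector Carrier (order H)
    w _ = 0#

  balanced-∪ʳ : ∀ {G H x} → BalancedEigenvalue H x → BalancedEigenvalue (G ∪ H) x
  balanced-∪ʳ {G} {H} {x} (v , v≉0 , s≈0 , eig) = u ++ v
    , (λ z → v≉0 λ i → trans (reflexive (≡.sym (lookup-++ʳ u v i))) (z (order G ↑ʳ i)))
    , trans (sum-++ u v) (trans (+-cong (sum-replicate-zero (order G)) s≈0) (+-identityʳ 0#))
    , eigenvector-++ G H (zero-eigenvector G x) eig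
    where
    u : Vector Carrier (order G)
    u _ = 0#

  -- Existence of the eigenvalues in characteristic zero.

  module CharacteristicZero (char0 : ∀ {n} → 0 < n → ¬ ⟦ n ⟧ ≈ 0#) where

    1≉0 : ¬ 1# ≈ 0#
    1≉0 1≈0 = char0 {1} z<s (trans (+-identityʳ 1#) 1≈0)

    zero-eigenvalue : ∀ G → 0 < order G → L.IsEigenvalue (L.laplacian G) 0#
    zero-eigenvalue G 0<n = (λ _ → 1#) , (λ z → 1≉0 (z (fromℕ< 0<n))) , constant-eigenvector G 1#

    -- The vector is constant on each part, with value `order H` on `G` and minus `order G` on `H`,
    -- so that the two parts have opposite sums.
    balanced-∪-zero : ∀ {G H} → 0 < order G → 0 < order H → BalancedEigenvalue (G ∪ H) 0#
    balanced-∪-zero {G} {H} 0<g 0<h = u ++ w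
      , (λ z → char0 0<h (trans (reflexive (≡.sym (lookup-++ˡ u w (fromℕ< 0<g)))) (z (fromℕ< 0<g ↑ˡ order H))))
      , (begin
          sum (u ++ w)                  ≈⟨ sum-++ u w ⟩
          sum u + sum w                 ≈⟨ +-cong (sum-const (order G) h) (sum-const (order H) (- g)) ⟩
          g * h + h * - g               ≈⟨ +-cong (*-comm g h) (sym (-‿distribʳ-* h g)) ⟩
          h * g - h * g                 ≈⟨ -‿inverseʳ _ ⟩
          0#                            ∎)
      , eigenvector-++ G H (constant-eigenvector G h) (constant-eigenvector H (- g))
      where
      g h : Carrier
      g = ⟦ order G ⟧
      h = ⟦ order H ⟧
      u : Vector Carrier (order G)
      u _ = h
      w : Vector Carrier (order H)
      w _ = - g

    -- The witness has entries `1` and `- 1` on two vertices and zero elsewhere; `K n` multiplies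
    -- every vector of sum zero by `n`.
    balanced-K : ∀ {n} → 2 ≤ n → BalancedEigenvalue (K n) ⟦ n ⟧
    balanced-K {suc (suc n)} (s≤s (s≤s _)) = v , (λ z → 1≉0 (z zero)) , s≈0 , λ i → begin
      Δ (K (2 ℕ.+ n)) v i         ≈⟨ Δ-K (2 ℕ.+ n) v i ⟩
      ⟦ 2 ℕ.+ n ⟧ * v i - sum v   ≈⟨ +-congˡ (-‿cong s≈0) ⟩
      ⟦ 2 ℕ.+ n ⟧ * v i - 0#      ≈⟨ x-0≈x _ ⟩
      ⟦ 2 ℕ.+ n ⟧ * v i           ∎
      where
      v : Vector Carrier (2 ℕ.+ n)
      v zero          = 1#
      v (suc zero)    = - 1#
      v (suc (suc _)) = 0#
      s≈0 : sum v ≈ 0#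
      s≈0 = trans (+-congˡ (trans (+-congˡ (sum-replicate-zero n)) (+-identityʳ _))) (-‿inverseʳ 1#)

    module _ {p : ℕ} (2≤p : 2 ≤ p) where

      private
        0<p : 0 < p
        0<p = ℕₚ.<-trans z<s 2≤p

      order-tower-pos : ∀ m → 0 < order (tower p m)
      order-tower-pos zero    = 0<p
      order-tower-pos (suc m) = ℕₚ.<-≤-trans (order-tower-pos m) (ℕₚ.m≤m+n _ p)

      -- The tower step sends a balanced eigenvalue l p to (m + 2 - l) p; the values l = 0 and l = 1
      -- come from the union itself and from its clique, so no eigenvalue of tower p 0 is needed.
      balanced-tower : ∀ m j l → suc j ℕ.+ l ≡ suc (suc m) → BalancedEigenvalue (tower p (suc m)) ⟦ suc j ℕ.* p ⟧
      balanced-tower m j l eq = balanced-complement {tower p m ∪ K p} complementary (previous m l eq)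
        where
        complementary : ⟦ l ℕ.* p ⟧ + ⟦ suc j ℕ.* p ⟧ ≈ ⟦ order (tower p m ∪ K p) ⟧
        complementary = trans (sym (×-homo-+ 1# (l ℕ.* p) (suc j ℕ.* p))) (×-congˡ
          (≡.trans (≡.sym (ℕₚ.*-distribʳ-+ p l (suc j)))
            (≡.trans (≡.cong (ℕ._* p) (≡.trans (ℕₚ.+-comm l (suc j)) eq)) (≡.sym (order-tower p (suc m))))))
        previous : ∀ m l → suc j ℕ.+ l ≡ suc (suc m) → BalancedEigenvalue (tower p m ∪ K p) ⟦ l ℕ.* p ⟧
        previous m       zero          _  = balanced-∪-zero {tower p m} {K p} (order-tower-pos m) 0<p
        previous m       (suc zero)    _  = ≡.subst (λ n → BalancedEigenvalue (tower p m ∪ K p) ⟦ n ⟧)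
          (≡.sym (ℕₚ.*-identityˡ p)) (balanced-∪ʳ {tower p m} (balanced-K 2≤p))
        previous zero    (suc (suc l)) eq = contradiction
          (ℕₚ.suc-injective (≡.trans (≡.sym (ℕₚ.+-suc j (suc l))) (ℕₚ.suc-injective eq)))
          (ℕₚ.m+1+n≢0 j)
        -- The two indices swap roles: in the smaller tower `(l + 2) p` is the partner of `j p`, and
        -- `l + 2 + j` is its number of entries.
        previous (suc m) (suc (suc l)) eq = balanced-∪ˡ {tower p (suc m)}
          (balanced-tower m (suc l) j (≡.trans (ℕₚ.+-comm (suc (suc l)) j) (ℕₚ.suc-injective eq)))

  -- Exclusion of all other eigenvalues over an integral domain.

  module IntegralDomain (cancel : ∀ {x y} → ¬ x ≈ 0# → x * y ≈ 0# → y ≈ 0#) where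

    -- A positive form of "`x` is not an eigenvalue", which can be proved entry by entry without
    -- deciding equality in the ring.
    EigenvectorsVanish : Graph → Carrier → Set (c ⊔ˡ ℓ)
    EigenvectorsVanish G x = ∀ v → IsEigenvector G x v → ∀ i → v i ≈ 0#

    -- As `y` is nonzero, an eigenvector of the complement has sum zero, and is then an eigenvector
    -- of `G` for `x`.
    vanish-complement : ∀ {G x y} → x + y ≈ ⟦ order G ⟧ → ¬ y ≈ 0# → EigenvectorsVanish G x → EigenvectorsVanish (complement G) y
    vanish-complement {G} {x} {y} x+y≈n y≉0 vanish v eig = vanish v λ i →
      +-cancelˡ (Δ (complement G) v i) _ _ (trans (complement-balance G x+y≈n s≈0 i) (+-congʳ (sym (eig i))))
      where
      s≈0 : sum v ≈ 0#
      s≈0 = cancel y≉0 (sum-eigenvector {complement G} eig)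

    vanish-∪ : ∀ {G H x} → EigenvectorsVanish G x → EigenvectorsVanish H x → EigenvectorsVanish (G ∪ H) x
    vanish-∪ {G} {H} vG vH v eig = ∪-elim G H
      (vG (λ i → v (i ↑ˡ order H)) λ i → trans (sym (Δ-∪ˡ G H v i)) (eig (i ↑ˡ order H)))
      (vH (λ i → v (order G ↑ʳ i)) λ i → trans (sym (Δ-∪ʳ G H v i)) (eig (order G ↑ʳ i)))

    -- For `x` nonzero the vector has sum zero, and there `K n` acts as the scalar `n`.
    vanish-K : ∀ {n x} → ¬ x ≈ 0# → ¬ x ≈ ⟦ n ⟧ → EigenvectorsVanish (K n) x
    vanish-K {n} {x} x≉0 x≉n v eig i = cancel (λ d → x≉n (x∙y⁻¹≈ε⇒x≈y _ _ d)) (begin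
      (x - ⟦ n ⟧) * v i     ≈⟨ [y-z]x≈yx-zx (v i) x ⟦ n ⟧ ⟩
      x * v i - ⟦ n ⟧ * v i ≈⟨ x≈y⇒x∙y⁻¹≈ε xv≈nv ⟩
      0#                    ∎)
      where
      xv≈nv : x * v i ≈ ⟦ n ⟧ * v i
      xv≈nv = begin
        x * v i             ≈⟨ eig i ⟨
        Δ (K n) v i         ≈⟨ Δ-K n v i ⟩
        ⟦ n ⟧ * v i - sum v ≈⟨ +-congˡ (-‿cong (cancel x≉0 (sum-eigenvector {K n} eig))) ⟩
        ⟦ n ⟧ * v i - 0#    ≈⟨ x-0≈x _ ⟩
        ⟦ n ⟧ * v i         ∎

    vanish-edgeless : ∀ {n x} → ¬ x ≈ 0# → EigenvectorsVanish (complement (K n)) x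
    vanish-edgeless {n} x≉0 v eig i = cancel x≉0 (trans (sym (eig i)) (Δ-edgeless n v i))

    -- The reflection of `x` in the order of the graph permutes the excluded multiples of `p`, so
    -- the reflected value avoids them too, in particular `0` and `p`, as the clique requires.
    vanish-tower : ∀ p m x → (∀ j → j ≤ suc m → ¬ x ≈ ⟦ j ℕ.* p ⟧) → EigenvectorsVanish (tower p m) x
    vanish-tower p zero    x x≉ = vanish-edgeless {p} (x≉ 0 z≤n)
    vanish-tower p (suc m) x x≉ = vanish-complement {tower p m ∪ K p} x′+x≈n (x≉ 0 z≤n)
      (vanish-∪ {tower p m} (vanish-tower p m x′ λ j j≤1+m → x′≉ j (ℕₚ.m≤n⇒m≤1+n j≤1+m))
                (vanish-K (x′≉ 0 z≤n) λ x′≈p → x′≉ 1 (s≤s z≤n) (trans x′≈p (×-congˡ (≡.sym (ℕₚ.*-identityˡ p))))))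
      where
      x′ : Carrier
      x′ = ⟦ order (tower p (suc m)) ⟧ - x
      x′+x≈n : x′ + x ≈ ⟦ order (tower p (suc m)) ⟧
      x′+x≈n = trans (+-assoc _ _ _) (trans (+-congˡ (-‿inverseˡ x)) (+-identityʳ _))
      x′≉ : ∀ j → j ≤ suc (suc m) → ¬ x′ ≈ ⟦ j ℕ.* p ⟧
      -- The order is `(m + 2) p`, so `j p` reflects to `(m + 2 - j) p`, again an excluded value.
      x′≉ j j≤2+m x′≈jp = x≉ (suc (suc m) ∸ j) (ℕₚ.m∸n≤m _ j) (+-cancelˡ x′ _ _ (begin
        x′ + x                                                  ≈⟨ x′+x≈n ⟩
        ⟦ order (tower p (suc m)) ⟧                             ≈⟨ ×-congˡ (order-tower p (suc m)) ⟩
        ⟦ suc (suc m) ℕ.* p ⟧                                   ≈⟨ ×-congˡ (≡.cong (ℕ._* p) (ℕₚ.m+[n∸m]≡n j≤2+m)) ⟨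
        ⟦ (j ℕ.+ (suc (suc m) ∸ j)) ℕ.* p ⟧                     ≈⟨ ×-congˡ (ℕₚ.*-distribʳ-+ p j (suc (suc m) ∸ j)) ⟩
        ⟦ j ℕ.* p ℕ.+ (suc (suc m) ∸ j) ℕ.* p ⟧                 ≈⟨ ×-homo-+ 1# (j ℕ.* p) _ ⟩
        ⟦ j ℕ.* p ⟧ + ⟦ (suc (suc m) ∸ j) ℕ.* p ⟧               ≈⟨ +-congʳ x′≈jp ⟨
        x′ + ⟦ (suc (suc m) ∸ j) ℕ.* p ⟧                        ∎))

-- Apartness and stability of equality for real numbers.

open Real using (ℝ; seq; cauchy; mk≈; converges; _≈_; 0ℝ; _+ℝ_; _*ℝ_; -ℝ_; ℝ-commutativeRing; half-pos; half+half; ∣p-q∣≡∣q-p∣; ⊔ˡ; ⊔ʳ)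

distance : ℝ → ℝ → ℕ → ℚ
distance x y n = ∣ seq x n ℚ.- seq y n ∣

Within : ℚ → ℝ → ℝ → Set
Within ε x y = ∃[ N ] (∀ n → N ≤ n → distance x y n ℚ.< ε)

-- The constructive strengthening of `¬ x ≈ y`: the explicit gap makes division possible.
Apart : ℝ → ℝ → Set
Apart x y = ∃[ δ ] (0ℚ ℚ.< δ × ∃[ N ] (∀ n → N ≤ n → δ ℚ.≤ distance x y n))

∣p-r∣≤∣p-q∣+∣q-r∣ : ∀ p q r → ∣ p ℚ.- r ∣ ℚ.≤ ∣ p ℚ.- q ∣ ℚ.+ ∣ q ℚ.- r ∣
∣p-r∣≤∣p-q∣+∣q-r∣ p q r = ≡.subst (λ t → ∣ t ∣ ℚ.≤ ∣ p ℚ.- q ∣ ℚ.+ ∣ q ℚ.- r ∣)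
  (+-*-Solver.solve 3 (λ p q r → (p :- q) :+ (q :- r) := p :- r) ≡.refl p q r)
  (ℚₚ.∣p+q∣≤∣p∣+∣q∣ (p ℚ.- q) (q ℚ.- r))
  where open +-*-Solver

∣p∣≤∣p-q∣+∣q∣ : ∀ p q → ∣ p ∣ ℚ.≤ ∣ p ℚ.- q ∣ ℚ.+ ∣ q ∣
∣p∣≤∣p-q∣+∣q∣ p q = ≡.subst (λ t → ∣ t ∣ ℚ.≤ ∣ p ℚ.- q ∣ ℚ.+ ∣ q ∣)
  (+-*-Solver.solve 2 (λ p q → (p :- q) :+ q := p) ≡.refl p q)
  (ℚₚ.∣p+q∣≤∣p∣+∣q∣ (p ℚ.- q) q)
  where open +-*-Solver

-- One rational comparison with ε/2 suffices, at an index after which the difference sequence varies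
-- by less than ε/4: below ε/2 it stays under ε, otherwise it stays at least ε/4 in absolute value.
within⊎apart : ∀ ε → 0ℚ ℚ.< ε → ∀ x y → Within ε x y ⊎ Apart x y
within⊎apart ε 0<ε x y with cauchy (x +ℝ (-ℝ y)) (½ ℚ.* (½ ℚ.* ε)) (half-pos _ (half-pos ε 0<ε))
... | N , close with distance x y N ℚₚ.<? ½ ℚ.* ε
...   | yes near = inj₁ (N , λ n N≤n → begin-strict
        ∣ z n ∣                                  ≤⟨ ∣p∣≤∣p-q∣+∣q∣ (z n) (z N) ⟩
        ∣ z n ℚ.- z N ∣ ℚ.+ ∣ z N ∣              <⟨ ℚₚ.+-mono-< (ℚₚ.<-trans (close n N N≤n ℕₚ.≤-refl) quarter<half) near ⟩
        ½ ℚ.* ε ℚ.+ ½ ℚ.* ε                      ≡⟨ half+half ε ⟩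
        ε                                        ∎)
  where
  open ℚₚ.≤-Reasoning
  z : ℕ → ℚ
  z n = seq x n ℚ.- seq y n
  quarter<half : ½ ℚ.* (½ ℚ.* ε) ℚ.< ½ ℚ.* ε
  quarter<half = begin-strict
    ½ ℚ.* (½ ℚ.* ε)                          ≡⟨ ℚₚ.+-identityʳ _ ⟨
    ½ ℚ.* (½ ℚ.* ε) ℚ.+ 0ℚ                   <⟨ ℚₚ.+-monoʳ-< (½ ℚ.* (½ ℚ.* ε)) (half-pos _ (half-pos ε 0<ε)) ⟩
    ½ ℚ.* (½ ℚ.* ε) ℚ.+ ½ ℚ.* (½ ℚ.* ε)      ≡⟨ half+half (½ ℚ.* ε) ⟩
    ½ ℚ.* ε                                  ∎
...   | no far = inj₂ (δ , half-pos _ (half-pos ε 0<ε) , N , λ n N≤n → ℚₚ.≮⇒≥ λ small →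
        ℚₚ.<-irrefl ≡.refl (begin-strict
          ½ ℚ.* ε                     ≤⟨ ℚₚ.≮⇒≥ far ⟩
          ∣ z N ∣                     ≤⟨ ∣p∣≤∣p-q∣+∣q∣ (z N) (z n) ⟩
          ∣ z N ℚ.- z n ∣ ℚ.+ ∣ z n ∣ <⟨ ℚₚ.+-mono-< (close N n ℕₚ.≤-refl N≤n) small ⟩
          δ ℚ.+ δ                     ≡⟨ half+half (½ ℚ.* ε) ⟩
          ½ ℚ.* ε                     ∎))
  where
  open ℚₚ.≤-Reasoning
  z : ℕ → ℚ
  z n = seq x n ℚ.- seq y n
  δ : ℚ
  δ = ½ ℚ.* (½ ℚ.* ε)

apart⇒≉ : ∀ {x y} → Apart x y → ¬ x ≈ y
apart⇒≉ (δ , 0<δ , M , far) x≈y with converges x≈y δ 0<δ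
... | N , near = ℚₚ.<-irrefl ≡.refl (ℚₚ.≤-<-trans (far (M ℕ.⊔ N) (ℕₚ.m≤m⊔n M N)) (near (M ℕ.⊔ N) (ℕₚ.m≤n⊔m M N)))

¬apart⇒≈ : ∀ {x y} → ¬ Apart x y → x ≈ y
¬apart⇒≈ {x} {y} ¬apart = mk≈ within
  where
  within : ∀ ε → 0ℚ ℚ.< ε → Within ε x y
  within ε 0<ε with within⊎apart ε 0<ε x y
  ... | inj₁ w = w
  ... | inj₂ a = contradiction a ¬apart

-- Equality is equivalent to the negation of `Apart`, and negations are stable under double
-- negation.
≈-stable : ∀ {x y} → ¬ ¬ x ≈ y → x ≈ y
≈-stable ¬¬x≈y = ¬apart⇒≈ λ a → ¬¬x≈y (apart⇒≉ a)

*ℝ-cancel-apart : ∀ {x y} → Apart x 0ℝ → x *ℝ y ≈ 0ℝ → y ≈ 0ℝ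
*ℝ-cancel-apart {x} {y} (δ , 0<δ , M , far) xy≈0 = mk≈ λ ε 0<ε →
  -- The tolerance is δ ε because dividing by `x`, of size at least δ, then leaves ε.
  let N , near = converges xy≈0 (δ ℚ.* ε) (δε-pos ε 0<ε)
  in M ℕ.⊔ N , λ n n≥ → ℚₚ.*-cancelˡ-<-nonNeg δ (begin-strict
       δ ℚ.* ∣ seq y n ℚ.- 0ℚ ∣         ≤⟨ ℚₚ.*-monoʳ-≤-nonNeg ∣ seq y n ℚ.- 0ℚ ∣ {{ℚₚ.∣-∣-nonNeg (seq y n ℚ.- 0ℚ)}} (far n (⊔ˡ M N n≥)) ⟩
       ∣ seq x n ℚ.- 0ℚ ∣ ℚ.* ∣ seq y n ℚ.- 0ℚ ∣ ≡⟨ ℚₚ.∣p*q∣≡∣p∣*∣q∣ (seq x n ℚ.- 0ℚ) (seq y n ℚ.- 0ℚ) ⟨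
       ∣ (seq x n ℚ.- 0ℚ) ℚ.* (seq y n ℚ.- 0ℚ) ∣ ≡⟨ ≡.cong ∣_∣ (drop-0 (seq x n) (seq y n)) ⟩
       ∣ seq x n ℚ.* seq y n ℚ.- 0ℚ ∣   <⟨ near n (⊔ʳ M N n≥) ⟩
       δ ℚ.* ε                          ∎)
  where
  open ℚₚ.≤-Reasoning
  instance
    δ-positive : ℚ.Positive δ
    δ-positive = ℚ.positive 0<δ
    δ-nonNegative : ℚ.NonNegative δ
    δ-nonNegative = ℚₚ.pos⇒nonNeg δ
  δε-pos : ∀ ε → 0ℚ ℚ.< ε → 0ℚ ℚ.< δ ℚ.* ε
  δε-pos ε 0<ε = ≡.subst (ℚ._< δ ℚ.* ε) (ℚₚ.*-zeroʳ δ) (ℚₚ.*-monoʳ-<-pos δ 0<ε)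
  drop-0 : ∀ a b → (a ℚ.- 0ℚ) ℚ.* (b ℚ.- 0ℚ) ≡ a ℚ.* b ℚ.- 0ℚ
  drop-0 a b = ≡.trans (≡.cong₂ ℚ._*_ (ℚₚ.+-identityʳ a) (ℚₚ.+-identityʳ b)) (≡.sym (ℚₚ.+-identityʳ (a ℚ.* b)))

-- The hypothesis yields apartness from zero only up to double negation, which is enough since the
-- conclusion is stable.
*ℝ-cancel : ∀ {x y} → ¬ x ≈ 0ℝ → x *ℝ y ≈ 0ℝ → y ≈ 0ℝ
*ℝ-cancel x≉0 xy≈0 = ≈-stable λ y≉0 → x≉0 (¬apart⇒≈ λ x#0 → y≉0 (*ℝ-cancel-apart x#0 xy≈0))

-- Natural numbers inside the reals.

open LaplacianOperator ℝ-commutativeRing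

⟦⟧-nonNegative : ∀ n i → 0ℚ ℚ.≤ seq ⟦ n ⟧ i
⟦⟧-nonNegative zero    i = ℚₚ.≤-refl
⟦⟧-nonNegative (suc n) i = ℚₚ.+-mono-≤ (ℚₚ.nonNegative⁻¹ 1ℚ) (⟦⟧-nonNegative n i)

⟦⟧-separated : ∀ m n → m ≢ n → ∀ i → 1ℚ ℚ.≤ distance ⟦ m ⟧ ⟦ n ⟧ i
⟦⟧-separated zero    zero    m≢n i = contradiction ≡.refl m≢n
⟦⟧-separated (suc m) zero    m≢n i = begin
  1ℚ                            ≤⟨ ℚₚ.+-monoʳ-≤ 1ℚ (⟦⟧-nonNegative m i) ⟩
  seq ⟦ suc m ⟧ i               ≡⟨ ℚₚ.0≤p⇒∣p∣≡p (⟦⟧-nonNegative (suc m) i) ⟨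
  ∣ seq ⟦ suc m ⟧ i ∣           ≡⟨ ≡.cong ∣_∣ (ℚₚ.+-identityʳ (seq ⟦ suc m ⟧ i)) ⟨
  ∣ seq ⟦ suc m ⟧ i ℚ.- 0ℚ ∣    ∎
  where open ℚₚ.≤-Reasoning
⟦⟧-separated zero    (suc n) m≢n i = ≡.subst (1ℚ ℚ.≤_) (∣p-q∣≡∣q-p∣ (seq ⟦ suc n ⟧ i) 0ℚ)
  (⟦⟧-separated (suc n) zero (m≢n ∘ ≡.sym) i)
⟦⟧-separated (suc m) (suc n) m≢n i = ≡.subst (λ t → 1ℚ ℚ.≤ ∣ t ∣)
  (+-*-Solver.solve 3 (λ o a b → a :- b := (o :+ a) :- (o :+ b)) ≡.refl 1ℚ (seq ⟦ m ⟧ i) (seq ⟦ n ⟧ i))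
  (⟦⟧-separated m n (m≢n ∘ ≡.cong suc) i)
  where open +-*-Solver using (_:+_; _:-_; _:=_)

⟦⟧-injective : ∀ {m n} → ⟦ m ⟧ ≈ ⟦ n ⟧ → m ≡ n
⟦⟧-injective {m} {n} eq with m ℕₚ.≟ n
... | yes m≡n = m≡n
... | no  m≢n = contradiction eq (apart⇒≉ (1ℚ , ℚₚ.positive⁻¹ 1ℚ , 0 , λ i _ → ⟦⟧-separated m n m≢n i))

-- Distinct naturals are at distance at least 1, while `x` would be at distance less than 1/2 from
-- both.
within½⇒≉ : ∀ {x m n} → Within ½ x ⟦ m ⟧ → m ≢ n → ¬ x ≈ ⟦ n ⟧
within½⇒≉ {x} {m} {n} (M , near) m≢n x≈n with converges x≈n ½ (ℚₚ.positive⁻¹ ½)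
... | N , near′ = ℚₚ.<-irrefl ≡.refl (begin-strict
  1ℚ                                    ≤⟨ ⟦⟧-separated m n m≢n i ⟩
  distance ⟦ m ⟧ ⟦ n ⟧ i                ≤⟨ ∣p-r∣≤∣p-q∣+∣q-r∣ (seq ⟦ m ⟧ i) (seq x i) (seq ⟦ n ⟧ i) ⟩
  distance ⟦ m ⟧ x i ℚ.+ distance x ⟦ n ⟧ i ≡⟨ ≡.cong (ℚ._+ distance x ⟦ n ⟧ i) (∣p-q∣≡∣q-p∣ (seq ⟦ m ⟧ i) (seq x i)) ⟩
  distance x ⟦ m ⟧ i ℚ.+ distance x ⟦ n ⟧ i <⟨ ℚₚ.+-mono-< (near i (ℕₚ.m≤m⊔n M N)) (near′ i (ℕₚ.m≤n⊔m M N)) ⟩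
  ½ ℚ.+ ½                               ≡⟨⟩
  1ℚ                                    ∎)
  where
  open ℚₚ.≤-Reasoning
  i = M ℕ.⊔ N

∃⊎∀ : ∀ {n} {A B : Fin n → Set} → (∀ i → A i ⊎ B i) → ∃ A ⊎ (∀ i → B i)
∃⊎∀ {zero}  f = inj₂ λ ()
∃⊎∀ {suc n} f with f zero | ∃⊎∀ (f ∘ suc)
... | inj₁ a | _            = inj₁ (zero , a)
... | inj₂ _ | inj₁ (i , a) = inj₁ (suc i , a)
... | inj₂ b | inj₂ bs      = inj₂ λ { zero → b ; (suc i) → bs i }

-- Equality of reals is not decidable, but x is within 1/2 of at most one of the integers f i,
-- and being apart from all the others forces equality with that one.
locate : ∀ {n} (f : Fin n → ℕ) → (∀ {i j} → f i ≡ f j → i ≡ j) →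
         ∀ x → ¬ (∀ i → ¬ x ≈ ⟦ f i ⟧) → ∃[ i ] (x ≈ ⟦ f i ⟧)
locate f f-injective x ¬none with ∃⊎∀ (λ i → within⊎apart ½ (ℚₚ.positive⁻¹ ½) x ⟦ f i ⟧)
... | inj₂ apart      = contradiction (λ i → apart⇒≉ (apart i)) ¬none
... | inj₁ (i , near) = i , ≈-stable λ x≉fi → ¬none λ j → excluded x≉fi j
  where
  excluded : ¬ x ≈ ⟦ f i ⟧ → ∀ j → ¬ x ≈ ⟦ f j ⟧
  excluded x≉fi j with i ≟ j
  ... | yes ≡.refl = x≉fi
  ... | no  i≢j    = within½⇒≉ near (i≢j ∘ f-injective)

-- The real spectrum and its size.

open CharacteristicZero (λ 0<n n≈0 → ℕₚ.<⇒≢ 0<n (≡.sym (⟦⟧-injective {n = 0} n≈0)))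
open IntegralDomain *ℝ-cancel

-- `tower p (suc m)` has `m + 2` entries, so the multiples `j p` with `0 ≤ j ≤ m + 2` are `m + 3` in
-- number.
tower-eigenvalues : ∀ {p} → 2 ≤ p → ∀ m → DistinctLaplacianEigenvalues (tower p (suc m)) (3 ℕ.+ m)
tower-eigenvalues {p} 2≤p m = record
  { to        = λ j → ⟦ toℕ j ℕ.* p ⟧ , eigenvalue j
  ; cong      = λ { ≡.refl → Real.≈-refl }
  ; bijective = (λ eq → multiple-injective (⟦⟧-injective eq)) , surjective
  }
  where
  G = tower p (suc m)
  instance
    p-nonZero : NonZero p
    p-nonZero = >-nonZero (ℕₚ.<-trans z<s 2≤p)
  multiple-injective : {i j : Fin (3 ℕ.+ m)} → toℕ i ℕ.* p ≡ toℕ j ℕ.* p → i ≡ j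
  multiple-injective {i} {j} eq = toℕ-injective (ℕₚ.*-cancelʳ-≡ (toℕ i) (toℕ j) p eq)
  eigenvalue : (j : Fin (3 ℕ.+ m)) → IsEigenvalue (laplacian G) ⟦ toℕ j ℕ.* p ⟧
  -- Zero comes from a constant vector, the other multiples from vectors of sum zero.
  eigenvalue zero    = zero-eigenvalue G (order-tower-pos 2≤p (suc m))
  eigenvalue (suc j) = balanced⇒eigenvalue {G}
    (balanced-tower 2≤p m (toℕ j) (suc m ∸ toℕ j) (≡.cong suc (ℕₚ.m+[n∸m]≡n (s≤s⁻¹ (toℕ<n j)))))
  surjective : (y : ∃ (IsEigenvalue (laplacian G))) → ∃[ i ] (∀ {j} → j ≡ i → ⟦ toℕ j ℕ.* p ⟧ ≈ proj₁ y)
  surjective (x , v , v≉0 , eig) =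
    let i , x≈ip = locate (λ i → toℕ i ℕ.* p) multiple-injective x ¬none
    in i , λ { ≡.refl → Real.≈-sym x≈ip }
    where
    -- If `x` avoided every multiple, its eigenvector would vanish; `locate` extracts an index from
    -- this double negation.
    ¬none : ¬ ((i : Fin (3 ℕ.+ m)) → ¬ x ≈ ⟦ toℕ i ℕ.* p ⟧)
    ¬none none = v≉0 (vanish-tower p (suc m) x
      (λ j j≤2+m x≈jp → none (fromℕ< (s≤s j≤2+m))
        (≡.subst (λ t → x ≈ ⟦ t ℕ.* p ⟧) (≡.sym (toℕ-fromℕ< (s≤s j≤2+m))) x≈jp))
      v eig)

theorem3p2 : (k p : ℕ) (2≤k : 2 ≤ k) → 2 ∣ k → 2 ≤ p →
    DistinctLaplacianEigenvalues (C (replicate k (m<n⇒n≢0 2≤k) p)) (suc k)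
-- With `k = m + 2` entries the tower index is `m + 1`, since `tower p 0` already has one entry.
theorem3p2 (suc (suc m)) p (s≤s (s≤s z≤n)) _ 2≤p =
  ≡.subst (λ G → DistinctLaplacianEigenvalues G (3 ℕ.+ m)) (≡.sym (C-replicate≡tower p (suc m))) (tower-eigenvalues 2≤p m)
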